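{- The alternation depth of languages definable in $FO^2[<,\mathrm{bet}]$ is unbounded: for every $d\ge 1$ there exist a finite alphabet $A$ and a language $L\subseteq A^*$ definable by a sentence of $FO^2[<,\mathrm{bet}]$ over $A$ whose alternation depth is greater than $d$.
   Context: $FO[<]$ is first-order logic over finite words over a finite alphabet $A$, with the order $<$ on positions and unary predicates $a(x)$ ($a\in A$) meaning the letter at position $x$ is $a$. A formula in prefix form is a block of quantifiers followed by a quantifier-free formula; it is a $\Sigma_k$ formula if its quantifier prefix consists of $k$ alternating blocks of existential and universal quantifiers with the leftmost block existential. The alternation depth of a language $L\subseteq A^*$ definable in $FO[<]$ is the smallest $k$ such that $L$ is defined by a boolean combination of $\Sigma_k$ sentences of $FO[<]$ (with arbitrarily many variables). $FO^2[<,\mathrm{bet}]$ is the fragment of first-order logic using only two variable symbols (reusable), built from $<$, the unary letter predicates, and for each $a\in A$ the binary predicate $a(x,y)$ meaning that some position $z$ with $x<z<y$ carries the letter $a$. -}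

module Defs where

open import Data.Nat using (ℕ; zero; suc; _<_; _≤_)
open import Data.Nat.Properties using (_≟_)
open import Data.Fin using (Fin)
import Data.Fin as F
open import Data.Bool using (Bool; true; false; not; if_then_else_)
open import Data.List using (List; []; _∷_; length; _++_; concat)
open import Data.List.Relation.Unary.All using (All)
open import Data.List.Membership.Propositional using (_∈_)
open import Data.Maybe using (Maybe; just; nothing)
open import Data.Vec using (Vec; toList)
open import Data.Product using (Σ; _×_; _,_)
open import Data.Sum using (_⊎_)
open import Relation.Nullary using (¬_; yes; no)
open import Relation.Binary.PropositionalEquality using (_≡_; _≢_)

-- Words over the finite alphabet A = Fin n; positions are 0 .. length-1.

Word : ℕ → Set
Word n = List (Fin n)

letterAt : ∀ {n} → Word n → ℕ → Maybe (Fin n)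
letterAt []      _       = nothing
letterAt (a ∷ w) zero    = just a
letterAt (a ∷ w) (suc i) = letterAt w i

-- FO[<] : variables are natural numbers (arbitrarily many variables).
-- Quantifier-free formulas.

data QF (n : ℕ) : Set where
  lt   : ℕ → ℕ → QF n
  eq   : ℕ → ℕ → QF n
  lett : Fin n → ℕ → QF n
  neg  : QF n → QF n
  conj : QF n → QF n → QF n
  disj : QF n → QF n → QF n

varsQF : ∀ {n} → QF n → List ℕ
varsQF (lt x y)   = x ∷ y ∷ []
varsQF (eq x y)   = x ∷ y ∷ []
varsQF (lett a x) = x ∷ []
varsQF (neg φ)    = varsQF φ
varsQF (conj φ ψ) = varsQF φ ++ varsQF ψ
varsQF (disj φ ψ) = varsQF φ ++ varsQF ψ

Assign : Set
Assign = ℕ → ℕ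

update : Assign → ℕ → ℕ → Assign
update ρ x i y with y ≟ x
... | yes _ = i
... | no  _ = ρ y

evalQF : ∀ {n} → Word n → Assign → QF n → Set
evalQF w ρ (lt x y)   = ρ x < ρ y
evalQF w ρ (eq x y)   = ρ x ≡ ρ y
evalQF w ρ (lett a x) = letterAt w (ρ x) ≡ just a
evalQF w ρ (neg φ)    = ¬ evalQF w ρ φ
evalQF w ρ (conj φ ψ) = evalQF w ρ φ × evalQF w ρ ψ
evalQF w ρ (disj φ ψ) = evalQF w ρ φ ⊎ evalQF w ρ ψ

evalBlock : ∀ {n} → Word n → Bool → List ℕ → (Assign → Set) → Assign → Set
evalBlock w q     []       K ρ = K ρ
evalBlock w true  (x ∷ xs) K ρ =
  Σ ℕ (λ i → i < length w × evalBlock w true xs K (update ρ x i))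
evalBlock w false (x ∷ xs) K ρ =
  (i : ℕ) → i < length w → evalBlock w false xs K (update ρ x i)

evalPrefix : ∀ {n} → Word n → Bool → List (List ℕ) → (Assign → Set) → Assign → Set
evalPrefix w q []         K ρ = K ρ
evalPrefix w q (b ∷ bs)   K ρ = evalBlock w q b (evalPrefix w (not q) bs K) ρ

-- A Σ_k sentence in prefix form: k alternating blocks, the first one
-- existential, followed by a quantifier-free matrix all of whose variables
-- are bound by the prefix (so it is a sentence).
record SigmaSentence (n k : ℕ) : Set where
  constructor mkΣ
  field
    blocks : Vec (List ℕ) k
    matrix : QF n
    closed : All (_∈ concat (toList blocks)) (varsQF matrix)

-- The satisfaction relation for sentences (the assignment is irrelevant
-- since sentences are closed; we start from the constant-0 assignment).
_⊨Σ_ : ∀ {n k} → Word n → SigmaSentence n k → Set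
w ⊨Σ mkΣ bs m _ = evalPrefix w true (toList bs) (λ ρ → evalQF w ρ m) (λ _ → 0)

data BoolComb (n k : ℕ) : Set where
  atom : SigmaSentence n k → BoolComb n k
  bneg : BoolComb n k → BoolComb n k
  band : BoolComb n k → BoolComb n k → BoolComb n k
  bor  : BoolComb n k → BoolComb n k → BoolComb n k

_⊨BC_ : ∀ {n k} → Word n → BoolComb n k → Set
w ⊨BC atom φ   = w ⊨Σ φ
w ⊨BC bneg φ   = ¬ (w ⊨BC φ)
w ⊨BC band φ ψ = (w ⊨BC φ) × (w ⊨BC ψ)
w ⊨BC bor φ ψ  = (w ⊨BC φ) ⊎ (w ⊨BC ψ)

Var2 : Set
Var2 = Fin 2

data FO2 (n : ℕ) : Set where
  lt2   : Var2 → Var2 → FO2 n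
  eq2   : Var2 → Var2 → FO2 n
  lett2 : Fin n → Var2 → FO2 n
  bet   : Fin n → Var2 → Var2 → FO2 n
  neg2  : FO2 n → FO2 n
  conj2 : FO2 n → FO2 n → FO2 n
  disj2 : FO2 n → FO2 n → FO2 n
  ex2   : Var2 → FO2 n → FO2 n
  all2  : Var2 → FO2 n → FO2 n

data FreeIn {n : ℕ} (v : Var2) : FO2 n → Set where
  lt2ˡ   : ∀ y → FreeIn v (lt2 v y)
  lt2ʳ   : ∀ x → FreeIn v (lt2 x v)
  eq2ˡ   : ∀ y → FreeIn v (eq2 v y)
  eq2ʳ   : ∀ x → FreeIn v (eq2 x v)
  lett2ᶠ : ∀ a → FreeIn v (lett2 a v)
  betˡ   : ∀ a y → FreeIn v (bet a v y)
  betʳ   : ∀ a x → FreeIn v (bet a x v)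
  neg2ᶠ  : ∀ {φ} → FreeIn v φ → FreeIn v (neg2 φ)
  conj2ˡ : ∀ {φ ψ} → FreeIn v φ → FreeIn v (conj2 φ ψ)
  conj2ʳ : ∀ {φ ψ} → FreeIn v ψ → FreeIn v (conj2 φ ψ)
  disj2ˡ : ∀ {φ ψ} → FreeIn v φ → FreeIn v (disj2 φ ψ)
  disj2ʳ : ∀ {φ ψ} → FreeIn v ψ → FreeIn v (disj2 φ ψ)
  ex2ᶠ   : ∀ {x φ} → v ≢ x → FreeIn v φ → FreeIn v (ex2 x φ)
  all2ᶠ  : ∀ {x φ} → v ≢ x → FreeIn v φ → FreeIn v (all2 x φ)

IsSentence2 : ∀ {n} → FO2 n → Set
IsSentence2 φ = ∀ v → ¬ FreeIn v φ

Assign2 : Set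
Assign2 = Var2 → ℕ

update2 : Assign2 → Var2 → ℕ → Assign2
update2 ρ x i y with y F.≟ x
... | yes _ = i
... | no  _ = ρ y

eval2 : ∀ {n} → Word n → Assign2 → FO2 n → Set
eval2 w ρ (lt2 x y)     = ρ x < ρ y
eval2 w ρ (eq2 x y)     = ρ x ≡ ρ y
eval2 w ρ (lett2 a x)   = letterAt w (ρ x) ≡ just a
eval2 w ρ (bet a x y)   =
  Σ ℕ (λ z → ρ x < z × z < ρ y × letterAt w z ≡ just a)
eval2 w ρ (neg2 φ)      = ¬ eval2 w ρ φ
eval2 w ρ (conj2 φ ψ)   = eval2 w ρ φ × eval2 w ρ ψ
eval2 w ρ (disj2 φ ψ)   = eval2 w ρ φ ⊎ eval2 w ρ ψ
eval2 w ρ (ex2 x φ)     = Σ ℕ (λ i → i < length w × eval2 w (update2 ρ x i) φ)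
eval2 w ρ (all2 x φ)    = (i : ℕ) → i < length w → eval2 w (update2 ρ x i) φ

record FO2Sentence (n : ℕ) : Set where
  constructor mkFO2
  field
    formula  : FO2 n
    sentence : IsSentence2 formula

_⊨2_ : ∀ {n} → Word n → FO2Sentence n → Set
w ⊨2 mkFO2 φ _ = eval2 w (λ _ → 0) φ

DefinesSame : ∀ {n k} → FO2Sentence n → BoolComb n k → Set
DefinesSame φ ψ = ∀ w → ((w ⊨2 φ) → (w ⊨BC ψ)) × ((w ⊨BC ψ) → (w ⊨2 φ))

AltDepthGreaterThan : ∀ {n} → FO2Sentence n → ℕ → Set
AltDepthGreaterThan φ d = ∀ k → k ≤ d → ¬ Σ (BoolComb _ k) (λ ψ → DefinesSame φ ψ)

{-# OPTIONS --safe #-}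
-- Fraïssé's game for prefix formulas: Sim s u v holds when Duplicator can
-- answer the moves s, Spoiler starting in u; a block of quantifiers is a run
-- of picks and an alternation is a swap.  The words are built level by level:
-- with B = badₖ ℓₖ₊₁ and G = goodₖ ℓₖ₊₁,
--   goodₖ₊₁ = B^N   and   badₖ₊₁ = B^N G B^N.
-- Long powers are indistinguishable, so Duplicator can keep the block G away
-- from the picks of the first round; after the swap she only has to answer for
-- G against B.  So k alternations do not separate goodₖ from badₖ, while the
-- two-variable formulas goodᵢ₊₁(x) := "no y < x with letter ℓᵢ, without an ℓᵢ₊₁
-- between y and x, satisfies goodᵢ" distinguish them.
module Submission where

open import Defs
open import Data.Bool using (true; false)
open import Data.Empty using (⊥-elim)
open import Data.Fin using (Fin; toℕ; zero; suc)
open import Data.List using (List; []; _∷_; _++_; length; replicate; concat)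
open import Data.List.Membership.Propositional using (_∈_; _∉_)
open import Data.List.Membership.Propositional.Properties using (∈-++⁺ˡ; ∈-++⁺ʳ; ∈-++⁻; ∈-∃++)
open import Data.List.Properties using (++-assoc; ++-identityʳ; length-++; ∷-injective)
import Data.List.Relation.Unary.All as All
open import Data.List.Relation.Unary.Any using (here; there)
open import Data.Maybe using (just)
open import Data.Nat using (ℕ; zero; suc; _+_; _∸_; _<_; _≤_; z≤n; s≤s)
open import Data.Nat.Properties
open import Data.Product using (Σ; ∃; ∃₂; _×_; _,_; proj₁; proj₂)
open import Data.Sum using (_⊎_; inj₁; inj₂; [_,_]′)
open import Data.Unit using (⊤; tt)
open import Data.Vec using (toList)
open import Data.Vec.Properties using (length-toList)
open import Function using (_∘_)
open import Relation.Nullary using (¬_; yes; no)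
open import Relation.Binary.PropositionalEquality

-- Moves of the game and the arithmetic of block counts.

data Move : Set where
  pick swap : Move

-- Number of copies from which powers of a block look alike under the moves `s`. With `3t + 1`
-- copies, one can be singled out with `t` copies left on either side. Swaps are charged too,
-- because `Sim-insert` splits a power when a round ends.
threshold : List Move → ℕ
threshold []      = 0
threshold (_ ∷ s) = suc (threshold s + (threshold s + threshold s))

Close : ℕ → ℕ → ℕ → Set
Close t i j = i ≡ j ⊎ (t ≤ i × t ≤ j)

minus : ∀ i N t → i + suc t ≤ N → ∃ λ n → N ≡ i + suc n × t ≤ n
minus zero    (suc N) t (s≤s h) = N , refl , h
minus (suc i) (suc N) t (s≤s h) = let n , e , l = minus i N t h in n , cong suc e , l

minus′ : ∀ t N i → t + suc i ≤ N → ∃ λ n → N ≡ n + suc i × t ≤ n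
minus′ t N i h =
  N ∸ suc i , sym (m∸n+n≡m (≤-trans (m≤n+m (suc i) t) h)) ,
  subst (_≤ N ∸ suc i) (m+n∸n≡m t (suc i)) (∸-monoˡ-≤ (suc i) h)

short-sum : ∀ {t i} → i ≤ t → t + suc i ≤ suc (t + (t + t))
short-sum {t} {i} h = ≤-trans (≤-reflexive (+-suc t i)) (s≤s (+-monoʳ-≤ t (≤-trans h (m≤m+n t t))))

-- Serves a pick with many copies on its left: the left count stays long, and the right count is
-- copied if it is at most `t` and replaced by exactly `t` otherwise. `respond-left` serves the
-- other case, copying a short left count.
respond : ∀ t r N → suc (t + (t + t)) ≤ N → ∃₂ λ j r′ → N ≡ j + suc r′ × t ≤ j × Close t r r′
respond t r N h with ≤-total t r
... | inj₂ r≤t = let j , e , l = minus′ t N r (≤-trans (short-sum r≤t) h) in j , r , e , l , inj₁ refl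
... | inj₁ t≤r = let j , e , l = minus′ t N t (≤-trans (short-sum ≤-refl) h) in
                 j , t , e , l , inj₂ (t≤r , ≤-refl)

respond-left : ∀ t i N → i ≤ t → suc (t + (t + t)) ≤ N → ∃ λ n → N ≡ i + suc n × t ≤ n
respond-left t i N i≤t h = minus i N t (≤-trans (≤-trans (≤-reflexive swap-suc) (short-sum i≤t)) h)
  where
  swap-suc : i + suc t ≡ t + suc i
  swap-suc = trans (+-suc i t) (trans (cong suc (+-comm i t)) (sym (+-suc t i)))

rest-long : ∀ t i r → i ≤ t → suc (t + (t + t)) ≤ i + suc r → t ≤ r
rest-long t i r i≤t h = +-cancelˡ-≤ t t r (≤-pred (begin
  suc (t + t)       ≤⟨ s≤s (+-monoʳ-≤ t (m≤m+n t t)) ⟩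
  suc (t + (t + t)) ≤⟨ h ⟩
  i + suc r         ≤⟨ +-monoˡ-≤ (suc r) i≤t ⟩
  t + suc r         ≡⟨ +-suc t r ⟩
  suc (t + r)       ∎))
  where open ≤-Reasoning

shrink : ∀ t {N} → suc (t + (t + t)) ≤ N → t ≤ N
shrink t h = ≤-trans (≤-trans (m≤m+n t (t + t)) (n≤1+n _)) h

-- The game on words, their concatenations and powers.

module _ {A : Set} where

  -- Local form of the game: a pick cuts both words at a letter, and play goes on in the two gaps
  -- separately. The first component of the `pick` clause covers a pick made in some other gap,
  -- which uses up the move here without effect.
  Sim : List Move → List A → List A → Set
  Sim []         u v = ⊤
  Sim (swap ∷ s) u v = Sim s v u
  Sim (pick ∷ s) u v = Sim s u v ×
    (∀ u₀ a u₁ → u ≡ u₀ ++ a ∷ u₁ →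
     ∃₂ λ v₀ v₁ → v ≡ v₀ ++ a ∷ v₁ × Sim s u₀ v₀ × Sim s u₁ v₁)

  data SplitAt++ (u v p : List A) (a : A) (q : List A) : Set where
    inˡ : ∀ r → u ≡ p ++ a ∷ r → q ≡ r ++ v → SplitAt++ u v p a q
    inʳ : ∀ r → v ≡ r ++ a ∷ q → p ≡ u ++ r → SplitAt++ u v p a q

  splitAt++ : ∀ u v p a q → u ++ v ≡ p ++ a ∷ q → SplitAt++ u v p a q
  splitAt++ []      v p       a q e    = inʳ p e refl
  splitAt++ (x ∷ u) v []      a q refl = inˡ u refl refl
  splitAt++ (x ∷ u) v (y ∷ p) a q e with ∷-injective e
  ... | refl , e′ with splitAt++ u v p a q e′
  ... | inˡ r e₁ e₂ = inˡ r (cong (x ∷_) e₁) e₂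
  ... | inʳ r e₁ e₂ = inʳ r e₁ (cong (x ∷_) e₂)

  data SplitLast (w : List A) (b : A) (p : List A) (a : A) (q : List A) : Set where
    inside : ∀ r → w ≡ p ++ a ∷ r → q ≡ r ++ b ∷ [] → SplitLast w b p a q
    last   : p ≡ w → b ≡ a → SplitLast w b p a q

  splitLast : ∀ w b p a q → w ++ b ∷ [] ≡ p ++ a ∷ q → SplitLast w b p a q
  splitLast w b p a q e with splitAt++ w (b ∷ []) p a q e
  ... | inˡ r e₁ e₂       = inside r e₁ e₂
  ... | inʳ [] refl e₂    = last (trans e₂ (++-identityʳ w)) refl
  ... | inʳ (_ ∷ []) () _
  ... | inʳ (_ ∷ _ ∷ _) () _

  Sim-refl : ∀ s u → Sim s u u
  Sim-refl []         u = tt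
  Sim-refl (swap ∷ s) u = Sim-refl s u
  Sim-refl (pick ∷ s) u = Sim-refl s u , λ u₀ a u₁ e → u₀ , u₁ , e , Sim-refl s u₀ , Sim-refl s u₁

  -- The factor containing the pick supplies the answer; the other factor passes.
  Sim-++ : ∀ s {u u′ v v′} → Sim s u u′ → Sim s v v′ → Sim s (u ++ v) (u′ ++ v′)
  Sim-++ []         _ _ = tt
  Sim-++ (swap ∷ s) p q = Sim-++ s p q
  Sim-++ (pick ∷ s) {u} {u′} {v} {v′} (p , f) (q , g) = Sim-++ s p q , answer
    where
    answer : ∀ w₀ a w₁ → u ++ v ≡ w₀ ++ a ∷ w₁ →
      ∃₂ λ x₀ x₁ → u′ ++ v′ ≡ x₀ ++ a ∷ x₁ × Sim s w₀ x₀ × Sim s w₁ x₁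
    answer w₀ a w₁ e with splitAt++ u v w₀ a w₁ e
    ... | inˡ r e₁ refl =
      let x₀ , x₁ , e′ , h₀ , h₁ = f w₀ a r e₁ in
      x₀ , x₁ ++ v′ , trans (cong (_++ v′) e′) (++-assoc x₀ (a ∷ x₁) v′) , h₀ , Sim-++ s h₁ q
    ... | inʳ r e₁ refl =
      let x₀ , x₁ , e′ , h₀ , h₁ = g r a w₁ e₁ in
      u′ ++ x₀ , x₁ , trans (cong (u′ ++_) e′) (sym (++-assoc u′ x₀ (a ∷ x₁))) , Sim-++ s p h₀ , h₁

  -- A quantifier block shorter than its round leaves picks over; they are passed.
  Sim-drop : ∀ j s {u v} → Sim (replicate j pick ++ s) u v → Sim s u v
  Sim-drop zero    s h = h
  Sim-drop (suc j) s h = Sim-drop j s (proj₁ h)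

  rep : ℕ → List A → List A
  rep N w = concat (replicate N w)

  rep-+ : ∀ i j w → rep (i + j) w ≡ rep i w ++ rep j w
  rep-+ zero    j w = refl
  rep-+ (suc i) j w = trans (cong (w ++_) (rep-+ i j w)) (sym (++-assoc w (rep i w) (rep j w)))

  record RepSplit (N : ℕ) (w p : List A) (a : A) (q : List A) : Set where
    constructor repSplit
    field
      {i r}   : ℕ
      {w₀ w₁} : List A
      count   : N ≡ i + suc r
      block   : w ≡ w₀ ++ a ∷ w₁
      left    : p ≡ rep i w ++ w₀
      right   : q ≡ w₁ ++ rep r w

  splitRep : ∀ N w p a q → rep N w ≡ p ++ a ∷ q → RepSplit N w p a q
  splitRep zero    w []      a q ()
  splitRep zero    w (_ ∷ _) a q ()
  splitRep (suc N) w p a q e with splitAt++ w (rep N w) p a q e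
  ... | inˡ r e₁ e₂ = repSplit {i = 0} refl e₁ refl e₂
  ... | inʳ r e₁ refl with splitRep N w r a q e₁
  ... | repSplit {i = i} {w₀ = w₀} c b l r′ =
    repSplit {i = suc i} (cong suc c) b (trans (cong (w ++_) l) (sym (++-assoc w (rep i w) w₀))) r′

  joinRep : ∀ i {w w₀ a w₁} z → w ≡ w₀ ++ a ∷ w₁ →
    rep i w ++ (w ++ z) ≡ (rep i w ++ w₀) ++ a ∷ (w₁ ++ z)
  joinRep i {w} {w₀} {a} {w₁} z refl = trans
    (cong (rep i w ++_) (++-assoc w₀ (a ∷ w₁) z)) (sym (++-assoc (rep i w) w₀ (a ∷ w₁ ++ z)))

  -- A pick is answered at the same place of a copy of `w` whose numbers of copies to the left and
  -- to the right are `Close` to Spoiler's.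
  Sim-rep : ∀ s w M N → threshold s ≤ M → threshold s ≤ N → Sim s (rep M w) (rep N w)
  Sim-rep-close : ∀ s w {M N} → Close (threshold s) M N → Sim s (rep M w) (rep N w)

  Sim-rep-close s w {M} (inj₁ refl)  = Sim-refl s (rep M w)
  Sim-rep-close s w (inj₂ (h , k)) = Sim-rep s w _ _ h k

  Sim-rep []         w M N h k = tt
  Sim-rep (swap ∷ s) w M N h k = Sim-rep s w N M (shrink (threshold s) k) (shrink (threshold s) h)
  Sim-rep (pick ∷ s) w M N h k = Sim-rep s w M N (shrink t h) (shrink t k) , answer
    where
    t = threshold s

    -- A short left count is copied exactly, and then the right is long in both words; if the left
    -- is long, `respond` settles both sides.
    place : ∀ i r → M ≡ i + suc r → ∃₂ λ j r′ → N ≡ j + suc r′ × Close t i j × Close t r r′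
    place i r refl with ≤-total t i
    ... | inj₁ t≤i = let j , r′ , e , l , c = respond t r N k in j , r′ , e , inj₂ (t≤i , l) , c
    ... | inj₂ i≤t = let r′ , e , l = respond-left t i N i≤t k in
                     i , r′ , e , inj₁ refl , inj₂ (rest-long t i r i≤t h , l)

    answer : ∀ u₀ a u₁ → rep M w ≡ u₀ ++ a ∷ u₁ →
      ∃₂ λ v₀ v₁ → rep N w ≡ v₀ ++ a ∷ v₁ × Sim s u₀ v₀ × Sim s u₁ v₁
    answer u₀ a u₁ e with splitRep M w u₀ a u₁ e
    ... | repSplit {i} {r} {w₀} {w₁} c b refl refl with place i r c
    ... | j , r′ , refl , ci , cr =
      rep j w ++ w₀ , w₁ ++ rep r′ w ,
      trans (rep-+ j (suc r′) w) (joinRep j (rep r′ w) b) ,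
      Sim-++ s (Sim-rep-close s w ci) (Sim-refl s w₀) ,
      Sim-++ s (Sim-refl s w₁) (Sim-rep-close s w cr)

  -- Before the swap, picks fall in the pure power and are answered among the copies of `w`, so `x`
  -- stays inside one gap with long powers on both sides. It becomes visible to Spoiler only after
  -- the swap, where it faces a single `w` and `Sim s x w` applies.
  Sim-insert : ∀ j s {w x} → Sim s x w → let s′ = replicate j pick ++ swap ∷ s in
    ∀ N N₁ N₂ → threshold s′ ≤ N → threshold s′ ≤ N₁ → threshold s′ ≤ N₂ →
    Sim s′ (rep N w) (rep N₁ w ++ (x ++ rep N₂ w))
  -- The swap comes next. Asking `respond` for `t` copies on the right cuts the power into two long
  -- ends and one `w`, which answers for `x`.
  Sim-insert zero s {w} {x} x≼w N N₁ N₂ h h₁ h₂ with respond (threshold s) (threshold s) N h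
  ... | i , r , refl , l , c = subst (Sim s _) (sym (rep-+ i (suc r) w))
    (Sim-++ s (Sim-rep s w N₁ i (shrink t h₁) l) (Sim-++ s x≼w (Sim-rep s w N₂ r (shrink t h₂) (long c))))
    where
    t = threshold s
    long : Close t t r → t ≤ r
    long (inj₁ refl)    = ≤-refl
    long (inj₂ (_ , k)) = k
  Sim-insert (suc j) s {w} {x} x≼w N N₁ N₂ h h₁ h₂ =
    Sim-insert j s x≼w N N₁ N₂ (shrink t h) (shrink t h₁) (shrink t h₂) , answer
    where
    s′ = replicate j pick ++ swap ∷ s
    t = threshold s′

    answer : ∀ u₀ a u₁ → rep N w ≡ u₀ ++ a ∷ u₁ →
      ∃₂ λ v₀ v₁ → rep N₁ w ++ (x ++ rep N₂ w) ≡ v₀ ++ a ∷ v₁ × Sim s′ u₀ v₀ × Sim s′ u₁ v₁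
    answer u₀ a u₁ e with splitRep N w u₀ a u₁ e
    ... | repSplit {i} {r} {w₀} {w₁} refl b refl refl with ≤-total t i
    -- Many copies to the left of the pick: the answer lies after `x`, which stays in the left gap.
    ... | inj₁ t≤i with respond t r N₂ h₂
    ... | n₂ , r′ , refl , l , c =
      (rep N₁ w ++ (x ++ rep n₂ w)) ++ w₀ , w₁ ++ rep r′ w ,
      (begin
        rep N₁ w ++ (x ++ rep (n₂ + suc r′) w)
          ≡⟨ cong (λ z → rep N₁ w ++ (x ++ z)) (trans (rep-+ n₂ (suc r′) w) (joinRep n₂ (rep r′ w) b)) ⟩
        rep N₁ w ++ (x ++ ((rep n₂ w ++ w₀) ++ z))
          ≡⟨ cong (λ z′ → rep N₁ w ++ (x ++ z′)) (++-assoc (rep n₂ w) w₀ z) ⟩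
        rep N₁ w ++ (x ++ (rep n₂ w ++ (w₀ ++ z)))
          ≡⟨ cong (rep N₁ w ++_) (++-assoc x (rep n₂ w) (w₀ ++ z)) ⟨
        rep N₁ w ++ ((x ++ rep n₂ w) ++ (w₀ ++ z))
          ≡⟨ ++-assoc (rep N₁ w) (x ++ rep n₂ w) (w₀ ++ z) ⟨
        (rep N₁ w ++ (x ++ rep n₂ w)) ++ (w₀ ++ z)
          ≡⟨ ++-assoc (rep N₁ w ++ (x ++ rep n₂ w)) w₀ z ⟨
        ((rep N₁ w ++ (x ++ rep n₂ w)) ++ w₀) ++ z ∎) ,
      Sim-++ s′ (Sim-insert j s x≼w i N₁ n₂ t≤i (shrink t h₁) l) (Sim-refl s′ w₀) ,
      Sim-++ s′ (Sim-refl s′ w₁) (Sim-rep-close s′ w c)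
      where
      open ≡-Reasoning
      z = a ∷ (w₁ ++ rep r′ w)
    -- Few copies to the left: the left gap is copied verbatim and `x` stays in the right gap.
    answer u₀ a u₁ e | repSplit {i} {r} {w₀} {w₁} refl b refl refl | inj₂ i≤t
      with respond-left t i N₁ i≤t h₁
    ... | n₁ , refl , l =
      rep i w ++ w₀ , w₁ ++ (rep n₁ w ++ (x ++ rep N₂ w)) ,
      (begin
        rep (i + suc n₁) w ++ z         ≡⟨ cong (_++ z) (rep-+ i (suc n₁) w) ⟩
        (rep i w ++ (w ++ rep n₁ w)) ++ z ≡⟨ ++-assoc (rep i w) (w ++ rep n₁ w) z ⟩
        rep i w ++ ((w ++ rep n₁ w) ++ z) ≡⟨ cong (rep i w ++_) (++-assoc w (rep n₁ w) z) ⟩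
        rep i w ++ (w ++ (rep n₁ w ++ z)) ≡⟨ joinRep i (rep n₁ w ++ z) b ⟩
        (rep i w ++ w₀) ++ a ∷ (w₁ ++ (rep n₁ w ++ z)) ∎) ,
      Sim-refl s′ (rep i w ++ w₀) ,
      Sim-++ s′ (Sim-refl s′ w₁)
        (Sim-insert j s x≼w r n₁ N₂ (rest-long t i r i≤t h) l (shrink t h₂))
      where
      open ≡-Reasoning
      z = x ++ rep N₂ w

-- Rounds of the game and positions in words.

rounds : ℕ → ℕ → List Move
rounds zero    m = []
rounds (suc k) m = replicate m pick ++ swap ∷ rounds k m

letterAt-length : ∀ {n} (p : Word n) q → letterAt (p ++ q) (length p) ≡ letterAt q 0
letterAt-length []      q = refl
letterAt-length (_ ∷ p) q = letterAt-length p q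

letterAt-++ˡ : ∀ {n} (p : Word n) q {i} → i < length p → letterAt (p ++ q) i ≡ letterAt p i
letterAt-++ˡ (_ ∷ p) q {zero}  h       = refl
letterAt-++ˡ (_ ∷ p) q {suc i} (s≤s h) = letterAt-++ˡ p q h

letterAt-++ʳ : ∀ {n} (p : Word n) q i → letterAt (p ++ q) (length p + i) ≡ letterAt q i
letterAt-++ʳ []      q i = refl
letterAt-++ʳ (_ ∷ p) q i = letterAt-++ʳ p q i

letterAt-marked : ∀ {n} (p : Word n) a q r → letterAt ((p ++ a ∷ q) ++ r) (length p) ≡ just a
letterAt-marked p a q r =
  trans (cong (λ w → letterAt w (length p)) (++-assoc p (a ∷ q) r)) (letterAt-length p _)

length-< : ∀ {A : Set} (p : List A) a q → length p < length (p ++ a ∷ q)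
length-< p a q = subst (length p <_) (sym (length-++ p)) (m<m+n _ (s≤s z≤n))

data Cut {A : Set} : List A → ℕ → Set where
  cut : ∀ p a q → Cut (p ++ a ∷ q) (length p)

cutAt : ∀ {A : Set} (w : List A) i → i < length w → Cut w i
cutAt (a ∷ w) zero    h = cut [] a w
cutAt (a ∷ w) (suc i) (s≤s h) with cutAt w i h
... | cut p b q = cut (a ∷ p) b q

data Side (m n : ℕ) : ℕ → Set where
  before : ∀ {i} → i < m → Side m n i
  at     : Side m n m
  after  : ∀ i → i < n → Side m n (m + suc i)

side : ∀ m n i → i < m + suc n → Side m n i
side zero    n zero    h       = at
side zero    n (suc i) (s≤s h) = after i h
side (suc m) n zero    h       = before (s≤s z≤n)
side (suc m) n (suc i) (s≤s h) with side m n i h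
... | before h′  = before (s≤s h′)
... | at         = at
... | after j h′ = after j h′

-- Pebbled words: from games to the truth of prefix formulas.

module _ {n : ℕ} where

  -- A position of the game: the pebbles placed so far cut both words into
  -- corresponding gaps.
  data Pebbled (s : List Move) : Word n → Word n → Set where
    gap  : ∀ {u v} → Sim s u v → Pebbled s u v
    node : ∀ {u₀ v₀ u₁ v₁} → Pebbled s u₀ v₀ → (a : Fin n) → Pebbled s u₁ v₁ →
           Pebbled s (u₀ ++ a ∷ u₁) (v₀ ++ a ∷ v₁)

  data Pebble {s : List Move} : ∀ {u v} → Pebbled s u v → ℕ → ℕ → Set where
    left  : ∀ {u₀ v₀ u₁ v₁ a i j} {l : Pebbled s u₀ v₀} {r : Pebbled s u₁ v₁} →
            Pebble l i j → Pebble (node l a r) i j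
    mid   : ∀ {u₀ v₀ u₁ v₁ a} {l : Pebbled s u₀ v₀} {r : Pebbled s u₁ v₁} →
            Pebble (node l a r) (length u₀) (length v₀)
    right : ∀ {u₀ v₀ u₁ v₁ a i j} {l : Pebbled s u₀ v₀} {r : Pebbled s u₁ v₁} →
            Pebble r i j → Pebble (node l a r) (length u₀ + suc i) (length v₀ + suc j)

  mapPebbled : ∀ {s t} → (∀ {u v} → Sim s u v → Sim t u v) → ∀ {u v} → Pebbled s u v → Pebbled t u v
  mapPebbled f (gap h)      = gap (f h)
  mapPebbled f (node l a r) = node (mapPebbled f l) a (mapPebbled f r)

  mapPebble : ∀ {s t} (f : ∀ {u v} → Sim s u v → Sim t u v) {u v} {P : Pebbled s u v} {i j} →
              Pebble P i j → Pebble (mapPebbled {t = t} f P) i j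
  mapPebble f (left p)  = left (mapPebble f p)
  mapPebble f mid       = mid
  mapPebble f (right p) = right (mapPebble f p)

  flipPebbled : ∀ {s u v} → Pebbled (swap ∷ s) u v → Pebbled s v u
  flipPebbled (gap h)      = gap h
  flipPebbled (node l a r) = node (flipPebbled l) a (flipPebbled r)

  flipPebble : ∀ {s u v} {P : Pebbled (swap ∷ s) u v} {i j} → Pebble P i j → Pebble (flipPebbled P) j i
  flipPebble (left p)  = left (flipPebble p)
  flipPebble mid       = mid
  flipPebble (right p) = right (flipPebble p)

  record Reply {s u v} (P : Pebbled (pick ∷ s) u v) (i : ℕ) : Set where
    field
      next   : Pebbled s u v
      answer : ℕ
      placed : Pebble next i answer
      kept   : ∀ {i′ j′} → Pebble P i′ j′ → Pebble next i′ j′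

  -- Only the gap containing `i` answers by its own game; all other gaps pass. A position already
  -- pebbled is answered by its partner.
  reply : ∀ {s u v} (P : Pebbled (pick ∷ s) u v) i → i < length u → Reply P i
  reply {u = u} (gap (_ , f)) i h with cutAt u i h
  ... | cut p a q with f p a q refl
  ... | v₀ , v₁ , refl , h₀ , h₁ = record
    { next = node (gap h₀) a (gap h₁) ; answer = length v₀ ; placed = mid ; kept = λ () }
  reply (node {u₀} {v₀} {u₁} l a r) i h
    with side (length u₀) (length u₁) i (subst (i <_) (length-++ u₀) h)
  ... | before h′ = record
    { next = node L.next a (mapPebbled proj₁ r) ; answer = L.answer ; placed = left L.placed
    ; kept = λ { (left p) → left (L.kept p) ; mid → mid ; (right p) → right (mapPebble proj₁ p) } }
    where module L = Reply (reply l i h′)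
  ... | at = record
    { next = node (mapPebbled proj₁ l) a (mapPebbled proj₁ r) ; answer = length v₀ ; placed = mid
    ; kept = λ { (left p) → left (mapPebble proj₁ p) ; mid → mid ; (right p) → right (mapPebble proj₁ p) } }
  ... | after i′ h′ = record
    { next = node (mapPebbled proj₁ l) a R.next ; answer = length v₀ + suc R.answer
    ; placed = right R.placed
    ; kept = λ { (left p) → left (mapPebble proj₁ p) ; mid → mid ; (right p) → right (R.kept p) } }
    where module R = Reply (reply r i′ h′)

  left-< : ∀ (p : Word n) a q {i} → i < length p → i < length (p ++ a ∷ q)
  left-< p a q h = <-≤-trans h (subst (length p ≤_) (sym (length-++ p)) (m≤m+n _ _))

  pebble-< : ∀ {s u v} {P : Pebbled s u v} {i j} → Pebble P i j → i < length u × j < length v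
  pebble-< {P = node {u₀} {v₀} l a r} (left p) = let h , k = pebble-< p in left-< u₀ a _ h , left-< v₀ a _ k
  pebble-< {P = node {u₀} {v₀} {u₁} {v₁} l a r} mid =
    length-< u₀ a u₁ , length-< v₀ a v₁
  pebble-< {P = node {u₀} {v₀} l a r} (right p) = let h , k = pebble-< p in
    subst (_ <_) (sym (length-++ u₀)) (+-monoʳ-< (length u₀) (s≤s h)) ,
    subst (_ <_) (sym (length-++ v₀)) (+-monoʳ-< (length v₀) (s≤s k))

  pebble-letter : ∀ {s u v} {P : Pebbled s u v} {i j} → Pebble P i j → letterAt u i ≡ letterAt v j
  pebble-letter {P = node {u₀} {v₀} l a r} (left p) =
    let h , k = pebble-< p in
    trans (letterAt-++ˡ u₀ _ h) (trans (pebble-letter p) (sym (letterAt-++ˡ v₀ _ k)))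
  pebble-letter {P = node {u₀} {v₀} l a r} mid =
    trans (letterAt-length u₀ _) (sym (letterAt-length v₀ _))
  pebble-letter {P = node {u₀} {v₀} l a r} (right p) =
    trans (letterAt-++ʳ u₀ _ _) (trans (pebble-letter p) (sym (letterAt-++ʳ v₀ _ _)))

  data SameOrder (i i′ j j′ : ℕ) : Set where
    less    : i < i′ → j < j′ → SameOrder i i′ j j′
    equal   : i ≡ i′ → j ≡ j′ → SameOrder i i′ j j′
    greater : i′ < i → j′ < j → SameOrder i i′ j j′

  -- In both words the order of the pebbles is the in-order traversal of the same tree.
  pebble-order : ∀ {s u v} {P : Pebbled s u v} {i i′ j j′} →
                 Pebble P i j → Pebble P i′ j′ → SameOrder i i′ j j′
  pebble-order (left p)  (left q)  = pebble-order p q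
  pebble-order (left p)  mid       = let h , k = pebble-< p in less h k
  pebble-order (left p)  (right q) = let h , k = pebble-< p in
    less (<-≤-trans h (m≤m+n _ _)) (<-≤-trans k (m≤m+n _ _))
  pebble-order mid       (left q)  = let h , k = pebble-< q in greater h k
  pebble-order mid       mid       = equal refl refl
  pebble-order mid       (right q) = less (m<m+n _ (s≤s z≤n)) (m<m+n _ (s≤s z≤n))
  pebble-order (right p) (left q)  = let h , k = pebble-< q in
    greater (<-≤-trans h (m≤m+n _ _)) (<-≤-trans k (m≤m+n _ _))
  pebble-order (right p) mid       = greater (m<m+n _ (s≤s z≤n)) (m<m+n _ (s≤s z≤n))
  pebble-order (right p) (right q) with pebble-order p q
  ... | less h k      = less (+-monoʳ-< _ (s≤s h)) (+-monoʳ-< _ (s≤s k))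
  ... | equal refl refl = equal refl refl
  ... | greater h k   = greater (+-monoʳ-< _ (s≤s h)) (+-monoʳ-< _ (s≤s k))

  evalQF-pebbled : ∀ {s u v} {P : Pebbled s u v} {ρ σ} (φ : QF n) →
    (∀ x → x ∈ varsQF φ → Pebble P (ρ x) (σ x)) →
    (evalQF u ρ φ → evalQF v σ φ) × (evalQF v σ φ → evalQF u ρ φ)
  evalQF-pebbled (lt x y) H with pebble-order (H x (here refl)) (H y (there (here refl)))
  ... | less h k    = (λ _ → k) , (λ _ → h)
  ... | equal h k   = (λ l → ⊥-elim (<-irrefl h l)) , (λ l → ⊥-elim (<-irrefl k l))
  ... | greater h k = (λ l → ⊥-elim (<-asym h l)) , (λ l → ⊥-elim (<-asym k l))
  evalQF-pebbled (eq x y) H with pebble-order (H x (here refl)) (H y (there (here refl)))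
  ... | less h k    = (λ e → ⊥-elim (<-irrefl e h)) , (λ e → ⊥-elim (<-irrefl e k))
  ... | equal h k   = (λ _ → k) , (λ _ → h)
  ... | greater h k = (λ e → ⊥-elim (<-irrefl (sym e) h)) , (λ e → ⊥-elim (<-irrefl (sym e) k))
  evalQF-pebbled (lett a x) H = let e = pebble-letter (H x (here refl)) in trans (sym e) , trans e
  evalQF-pebbled (neg φ) H = let f , g = evalQF-pebbled φ H in _∘ g , _∘ f
  evalQF-pebbled (conj φ ψ) H =
    let f , g   = evalQF-pebbled φ (λ x m → H x (∈-++⁺ˡ m))
        f′ , g′ = evalQF-pebbled ψ (λ x m → H x (∈-++⁺ʳ (varsQF φ) m))
    in (λ (p , q) → f p , f′ q) , (λ (p , q) → g p , g′ q)
  evalQF-pebbled (disj φ ψ) H =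
    let f , g   = evalQF-pebbled φ (λ x m → H x (∈-++⁺ˡ m))
        f′ , g′ = evalQF-pebbled ψ (λ x m → H x (∈-++⁺ʳ (varsQF φ) m))
    in [ inj₁ ∘ f , inj₂ ∘ f′ ]′ , [ inj₁ ∘ g , inj₂ ∘ g′ ]′

  module _ (φ : QF n) (m : ℕ) where

    -- `pending` holds the variables that the rest of the prefix binds. Until then a variable may
    -- carry an arbitrary value without a pebble, such as the initial 0; at the matrix `pending` is
    -- empty and every variable is pebbled.
    Tracked : ∀ {s u v} → Pebbled s u v → Assign → Assign → List ℕ → Set
    Tracked P ρ σ pending = ∀ x → x ∈ varsQF φ → Pebble P (ρ x) (σ x) ⊎ x ∈ pending

    tracked-map : ∀ {s t u v u′ v′} {P : Pebbled s u v} {Q : Pebbled t u′ v′} {ρ σ ρ′ σ′ pending} →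
      (∀ {x} → Pebble P (ρ x) (σ x) → Pebble Q (ρ′ x) (σ′ x)) →
      Tracked P ρ σ pending → Tracked Q ρ′ σ′ pending
    tracked-map f H x h = [ inj₁ ∘ f , inj₂ ]′ (H x h)

    tracked-pick : ∀ {s u v} {P : Pebbled (pick ∷ s) u v} {ρ σ y pending i} (R : Reply P i) →
      Tracked P ρ σ (y ∷ pending) →
      Tracked (Reply.next R) (update ρ y i) (update σ y (Reply.answer R)) pending
    tracked-pick {y = y} R H x h with x ≟ y
    ... | yes _   = inj₁ (Reply.placed R)
    ... | no  x≢y with H x h
    ... | inj₁ p             = inj₁ (Reply.kept R p)
    ... | inj₂ (here x≡y)    = ⊥-elim (x≢y x≡y)
    ... | inj₂ (there x∈)    = inj₂ x∈

    Matrix : Word n → Assign → Set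
    Matrix w ρ = evalQF w ρ φ

    -- Spoiler always plays in `u`. For an existential block the picks are the witnesses given in
    -- `u`, so truth passes from `u` to `v`; for a universal block they are the values to be checked
    -- in `u`, so truth passes from `v` to `u`. Exchanging the words at a swap therefore turns each
    -- statement into the other.
    exists-pebbled : ∀ k {u v ρ σ} bs (P : Pebbled (rounds k m) u v) →
      length bs ≤ k → length (concat bs) ≤ m → Tracked P ρ σ (concat bs) →
      evalPrefix u true bs (Matrix u) ρ → evalPrefix v true bs (Matrix v) σ
    forall-pebbled : ∀ k {u v ρ σ} bs (P : Pebbled (rounds k m) u v) →
      length bs ≤ k → length (concat bs) ≤ m → Tracked P ρ σ (concat bs) →
      evalPrefix v false bs (Matrix v) σ → evalPrefix u false bs (Matrix u) ρ
    exists-block : ∀ k j {u v ρ σ} xs bs (P : Pebbled (replicate j pick ++ swap ∷ rounds k m) u v) →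
      length xs ≤ j → length bs ≤ k → length (concat bs) ≤ m → Tracked P ρ σ (xs ++ concat bs) →
      evalBlock u true xs (evalPrefix u false bs (Matrix u)) ρ →
      evalBlock v true xs (evalPrefix v false bs (Matrix v)) σ
    forall-block : ∀ k j {u v ρ σ} xs bs (P : Pebbled (replicate j pick ++ swap ∷ rounds k m) u v) →
      length xs ≤ j → length bs ≤ k → length (concat bs) ≤ m → Tracked P ρ σ (xs ++ concat bs) →
      evalBlock v false xs (evalPrefix v true bs (Matrix v)) σ →
      evalBlock u false xs (evalPrefix u true bs (Matrix u)) ρ

    all-tracked : ∀ {s u v} {P : Pebbled s u v} {ρ σ} → Tracked P ρ σ [] →
      ∀ x → x ∈ varsQF φ → Pebble P (ρ x) (σ x)
    all-tracked H x h with H x h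
    ... | inj₁ p = p

    exists-pebbled k [] P _ _ H = proj₁ (evalQF-pebbled φ (all-tracked H))
    exists-pebbled (suc k) (b ∷ bs) P (s≤s h) c H =
      exists-block k m b bs P (≤-trans (m≤m+n _ _) c′) h (≤-trans (m≤n+m _ _) c′) H
      where c′ = subst (_≤ m) (length-++ b) c

    forall-pebbled k [] P _ _ H = proj₂ (evalQF-pebbled φ (all-tracked H))
    forall-pebbled (suc k) (b ∷ bs) P (s≤s h) c H =
      forall-block k m b bs P (≤-trans (m≤m+n _ _) c′) h (≤-trans (m≤n+m _ _) c′) H
      where c′ = subst (_≤ m) (length-++ b) c

    exists-block k j [] bs P _ h c H =
      forall-pebbled k bs (flipPebbled (mapPebbled (Sim-drop j _) P)) h c
        (tracked-map (flipPebble ∘ mapPebble (Sim-drop j _)) H)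
    exists-block k (suc j) (x ∷ xs) bs P (s≤s l) h c H (i , i< , e) =
      Reply.answer R , proj₂ (pebble-< (Reply.placed R)) ,
      exists-block k j xs bs (Reply.next R) l h c (tracked-pick R H) e
      where R = reply P i i<

    forall-block k j [] bs P _ h c H =
      exists-pebbled k bs (flipPebbled (mapPebbled (Sim-drop j _) P)) h c
        (tracked-map (flipPebble ∘ mapPebble (Sim-drop j _)) H)
    forall-block k (suc j) (x ∷ xs) bs P (s≤s l) h c H e i i< =
      forall-block k j xs bs (Reply.next R) l h c (tracked-pick R H)
        (e (Reply.answer R) (proj₂ (pebble-< (Reply.placed R))))
      where R = reply P i i<

  Sim⇒⊨Σ : ∀ d m {k u v} (φ : SigmaSentence n k) → k ≤ d →
    length (concat (toList (SigmaSentence.blocks φ))) ≤ m → Sim (rounds d m) u v → u ⊨Σ φ → v ⊨Σ φ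
  Sim⇒⊨Σ d m {k} (mkΣ bs φ cl) k≤d c h = exists-pebbled φ m d (toList bs) (gap h)
    (subst (_≤ d) (sym (length-toList bs)) k≤d) c (λ x x∈ → inj₂ (All.lookup cl x∈))

  width : ∀ {k} → BoolComb n k → ℕ
  width (atom φ)   = length (concat (toList (SigmaSentence.blocks φ)))
  width (bneg ψ)   = width ψ
  width (band ψ χ) = width ψ + width χ
  width (bor ψ χ)  = width ψ + width χ

  -- Negation calls for games in both directions. Their numbers of rounds are separate because the
  -- reverse game will be obtained from the forward one at the cost of a round.
  Sim⇒⊨BC : ∀ d e m {k u v} (ψ : BoolComb n k) → k ≤ d → k ≤ e → width ψ ≤ m →
    Sim (rounds d m) u v → Sim (rounds e m) v u → (u ⊨BC ψ → v ⊨BC ψ) × (v ⊨BC ψ → u ⊨BC ψ)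
  Sim⇒⊨BC d e m (atom φ) k≤d k≤e c h h′ = Sim⇒⊨Σ d m φ k≤d c h , Sim⇒⊨Σ e m φ k≤e c h′
  Sim⇒⊨BC d e m (bneg ψ) k≤d k≤e c h h′ = let f , g = Sim⇒⊨BC d e m ψ k≤d k≤e c h h′ in _∘ g , _∘ f
  Sim⇒⊨BC d e m (band ψ χ) k≤d k≤e c h h′ =
    let f , g   = Sim⇒⊨BC d e m ψ k≤d k≤e (≤-trans (m≤m+n _ _) c) h h′
        f′ , g′ = Sim⇒⊨BC d e m χ k≤d k≤e (≤-trans (m≤n+m _ _) c) h h′
    in (λ (p , q) → f p , f′ q) , (λ (p , q) → g p , g′ q)
  Sim⇒⊨BC d e m (bor ψ χ) k≤d k≤e c h h′ =
    let f , g   = Sim⇒⊨BC d e m ψ k≤d k≤e (≤-trans (m≤m+n _ _) c) h h′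
        f′ , g′ = Sim⇒⊨BC d e m χ k≤d k≤e (≤-trans (m≤n+m _ _) c) h h′
    in [ inj₁ ∘ f , inj₂ ∘ f′ ]′ , [ inj₁ ∘ g , inj₂ ∘ g′ ]′

-- Exponents, letters and betweenness.

exponent : ℕ → ℕ → ℕ
exponent m k = threshold (rounds (suc k) m)

-- Truncated at the largest letter to be total; letters are distinct only for indices up to `D`,
-- whence the bounds `suc k ≤ D` below.
letter : ∀ {D} → ℕ → Fin (suc D)
letter {zero}  _       = zero
letter {suc D} zero    = zero
letter {suc D} (suc k) = suc (letter k)

toℕ-letter : ∀ {D k} → k ≤ D → toℕ (letter {D} k) ≡ k
toℕ-letter {zero}  z≤n     = refl
toℕ-letter {suc D} z≤n     = refl
toℕ-letter {suc D} (s≤s h) = cong suc (toℕ-letter h)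

other : Var2 → Var2
other zero       = suc zero
other (suc zero) = zero

letterAt-∈ : ∀ {n} (w : Word n) q i {c} → i < length w → letterAt (w ++ q) i ≡ just c → c ∈ w
letterAt-∈ (a ∷ w) q zero    h refl    = here refl
letterAt-∈ (a ∷ w) q (suc i) (s≤s h) e = there (letterAt-∈ w q i h e)

bet⇒∈ : ∀ {n} (p : Word n) a q r {c i j} {w} → w ≡ (p ++ a ∷ q) ++ r →
  i ≡ length p → j ≡ length (p ++ a ∷ q) →
  Σ ℕ (λ z → i < z × z < j × letterAt w z ≡ just c) → c ∈ q
bet⇒∈ p a q r {c} refl refl refl (z , h , k , e)
  with minus (length p) z 0 (subst (_≤ z) (+-comm 1 (length p)) h)
... | z′ , refl , _ = letterAt-∈ q r z′
  (≤-pred (+-cancelˡ-< (length p) (suc z′) (suc (length q)) (subst (_ <_) (length-++ p) k)))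
  (begin
    letterAt (q ++ r) z′                 ≡⟨ letterAt-++ʳ p (a ∷ q ++ r) (suc z′) ⟨
    letterAt (p ++ a ∷ q ++ r) z         ≡⟨ cong (λ x → letterAt x z) (++-assoc p (a ∷ q) r) ⟨
    letterAt ((p ++ a ∷ q) ++ r) z       ≡⟨ e ⟩
    just c                               ∎)
  where open ≡-Reasoning

∈⇒bet : ∀ {n} (p : Word n) a q r {c i j} {w} → w ≡ (p ++ a ∷ q) ++ r →
  i ≡ length p → j ≡ length (p ++ a ∷ q) → c ∈ q →
  Σ ℕ (λ z → i < z × z < j × letterAt w z ≡ just c)
∈⇒bet p a q r {c} refl refl refl c∈ with ∈-∃++ c∈
... | x , y , refl = length p + suc (length x) , m<m+n _ (s≤s z≤n) ,
  subst (_ <_) (sym (length-++ p)) (+-monoʳ-< (length p) (s≤s (length-< x c y))) ,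
  (begin
    letterAt ((p ++ a ∷ x ++ c ∷ y) ++ r) (length p + suc (length x))
      ≡⟨ cong (λ w → letterAt w (length p + suc (length x))) (++-assoc p (a ∷ x ++ c ∷ y) r) ⟩
    letterAt (p ++ a ∷ (x ++ c ∷ y) ++ r) (length p + suc (length x))
      ≡⟨ letterAt-++ʳ p _ (suc (length x)) ⟩
    letterAt ((x ++ c ∷ y) ++ r) (length x)
      ≡⟨ letterAt-marked x c y r ⟩
    just c ∎)
  where open ≡-Reasoning

-- The two-variable formulas and their meaning on prefixes.

module _ {D : ℕ} where

  ℓ : ℕ → Fin (suc D)
  ℓ = letter

  mutual
    -- Each level rebinds the variable not in use, so two suffice at every depth. Witnesses lie to
    -- the left, so truth depends only on the prefix before the position.
    marked : ℕ → Var2 → FO2 (suc D)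
    marked k v = ex2 (other v) (conj2 (lt2 (other v) v) (conj2 (lett2 (ℓ k) (other v))
                   (conj2 (neg2 (bet (ℓ (suc k)) (other v) v)) (good k (other v)))))

    good : ℕ → Var2 → FO2 (suc D)
    good zero    v = eq2 v v
    good (suc k) v = neg2 (marked k v)

  mutual
    -- Good k p says that good k holds at the position that follows the prefix p.
    Marked : ℕ → Word (suc D) → Set
    Marked k p = ∃₂ λ p₀ p₁ → p ≡ p₀ ++ ℓ k ∷ p₁ × ℓ (suc k) ∉ p₁ × Good k p₀

    Good : ℕ → Word (suc D) → Set
    Good zero    p = ⊤
    Good (suc k) p = ¬ Marked k p

  update2-other : ∀ ρ v i → update2 ρ (other v) i (other v) ≡ i
  update2-other ρ zero       i = refl
  update2-other ρ (suc zero) i = refl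

  update2-same : ∀ ρ v i → update2 ρ (other v) i v ≡ ρ v
  update2-same ρ zero       i = refl
  update2-same ρ (suc zero) i = refl

  record Prefix (w p : Word (suc D)) (i : ℕ) : Set where
    constructor prefix
    field
      rest : Word (suc D)
      word : w ≡ p ++ rest
      pos  : i ≡ length p

  good⇒ : ∀ k {w p ρ} v → Prefix w p (ρ v) → eval2 w ρ (good k v) → Good k p
  good⇐ : ∀ k {w p ρ} v → Prefix w p (ρ v) → Good k p → eval2 w ρ (good k v)
  marked⇒ : ∀ k {w p ρ} v → Prefix w p (ρ v) → eval2 w ρ (marked k v) → Marked k p
  marked⇐ : ∀ k {w p ρ} v → Prefix w p (ρ v) → Marked k p → eval2 w ρ (marked k v)

  good⇒ zero    v P e = tt
  good⇒ (suc k) v P e = e ∘ marked⇐ k v P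
  good⇐ zero    v P e = refl
  good⇐ (suc k) v P e = e ∘ marked⇒ k v P

  marked⇒ k {w} {p} {ρ} v (prefix r refl x) (i , i< , i<p , le , nb , g)
    rewrite update2-other ρ v i | update2-same ρ v i | x with cutAt p i i<p
  ... | cut p₀ a p₁ with trans (sym le) (letterAt-marked p₀ a p₁ r)
  ... | refl = p₀ , p₁ , refl , (λ m → nb (∈⇒bet p₀ a p₁ r refl refl refl m)) ,
    good⇒ k (other v) (prefix (a ∷ p₁ ++ r) (++-assoc p₀ (a ∷ p₁) r) (update2-other ρ v (length p₀))) g

  marked⇐ k {w} {p} {ρ} v (prefix r refl x) (p₀ , p₁ , refl , nb , g) =
    length p₀ ,
    subst (length p₀ <_) (sym (length-++ p)) (<-≤-trans p₀< (m≤m+n _ _)) ,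
    subst₂ _<_ (sym other≡) (sym (trans (update2-same ρ v _) x)) p₀< ,
    trans (cong (letterAt w) other≡) (letterAt-marked p₀ (ℓ k) p₁ r) ,
    (λ b → nb (bet⇒∈ p₀ (ℓ k) p₁ r refl other≡ (trans (update2-same ρ v _) x) b)) ,
    good⇐ k (other v) (prefix (ℓ k ∷ p₁ ++ r) (++-assoc p₀ (ℓ k ∷ p₁) r) other≡) g
    where
    other≡ = update2-other ρ v (length p₀)
    p₀< = length-< p₀ (ℓ k) p₁

  free-good : ∀ k v u → FreeIn u (good k v) → u ≡ v
  free-good zero v u (eq2ˡ _) = refl
  free-good zero v u (eq2ʳ _) = refl
  free-good (suc k) v u (neg2ᶠ (ex2ᶠ u≢ (conj2ˡ (lt2ˡ _)))) = ⊥-elim (u≢ refl)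
  free-good (suc k) v u (neg2ᶠ (ex2ᶠ u≢ (conj2ˡ (lt2ʳ _)))) = refl
  free-good (suc k) v u (neg2ᶠ (ex2ᶠ u≢ (conj2ʳ (conj2ˡ (lett2ᶠ _))))) = ⊥-elim (u≢ refl)
  free-good (suc k) v u (neg2ᶠ (ex2ᶠ u≢ (conj2ʳ (conj2ʳ (conj2ˡ (neg2ᶠ (betˡ _ _))))))) = ⊥-elim (u≢ refl)
  free-good (suc k) v u (neg2ᶠ (ex2ᶠ u≢ (conj2ʳ (conj2ʳ (conj2ˡ (neg2ᶠ (betʳ _ _))))))) = refl
  free-good (suc k) v u (neg2ᶠ (ex2ᶠ u≢ (conj2ʳ (conj2ʳ (conj2ʳ f))))) = ⊥-elim (u≢ (free-good k (other v) u f))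

  badSentence : ℕ → FO2Sentence (suc D)
  badSentence k = mkFO2 (ex2 zero (conj2 (lett2 (ℓ k) zero) (good k zero))) closed
    where
    closed : IsSentence2 (ex2 zero (conj2 (lett2 (ℓ k) zero) (good k zero)))
    closed u (ex2ᶠ u≢ (conj2ˡ (lett2ᶠ _))) = u≢ refl
    closed u (ex2ᶠ u≢ (conj2ʳ f))          = u≢ (free-good k zero u f)

  bad⇒ : ∀ k {w} → w ⊨2 badSentence k → ∃₂ λ p₀ p₁ → w ≡ p₀ ++ ℓ k ∷ p₁ × Good k p₀
  bad⇒ k {w} (i , i< , le , g) with cutAt w i i<
  ... | cut p a q with trans (sym le) (letterAt-length p _)
  ... | refl = p , q , refl , good⇒ k zero (prefix _ refl refl) g

  bad⇐ : ∀ k {w} → (∃₂ λ p₀ p₁ → w ≡ p₀ ++ ℓ k ∷ p₁ × Good k p₀) → w ⊨2 badSentence k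
  bad⇐ k (p , q , refl , g) = length p ,
    length-< p _ q ,
    letterAt-length p _ , good⇐ k zero (prefix _ refl refl) g

  -- The words, the letters they contain and the letters they hide.

  mutual
    goodWord : (ℕ → ℕ) → ℕ → Word (suc D)
    goodWord N zero    = []
    goodWord N (suc k) = rep (N k) (badBlock N k)

    badWord : (ℕ → ℕ) → ℕ → Word (suc D)
    badWord N zero    = ℓ 0 ∷ []
    badWord N (suc k) = rep (N k) (badBlock N k) ++ (goodBlock N k ++ rep (N k) (badBlock N k))

    goodBlock badBlock : (ℕ → ℕ) → ℕ → Word (suc D)
    goodBlock N k = goodWord N k ++ ℓ (suc k) ∷ []
    badBlock  N k = badWord N k ++ ℓ (suc k) ∷ []

  ℓ-injective : ∀ {i j} → i ≤ D → j ≤ D → ℓ i ≡ ℓ j → i ≡ j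
  ℓ-injective h h′ e = trans (sym (toℕ-letter h)) (trans (cong toℕ e) (toℕ-letter h′))

  Below : ℕ → Word (suc D) → Set
  Below k w = ∀ j → k < j → j ≤ D → ℓ j ∉ w

  Below-++ : ∀ {k u v} → Below k u → Below k v → Below k (u ++ v)
  Below-++ {u = u} f g j h h′ m = [ f j h h′ , g j h h′ ]′ (∈-++⁻ u m)

  Below-rep : ∀ {k w} N → Below k w → Below k (rep N w)
  Below-rep zero    f j h h′ ()
  Below-rep (suc N) f = Below-++ f (Below-rep N f)

  Below-block : ∀ {k w} → suc k ≤ D → Below k w → Below (suc k) (w ++ ℓ (suc k) ∷ [])
  Below-block {w = w} k< f j h h′ m with ∈-++⁻ w m
  ... | inj₁ m′        = f j (<-trans (n<1+n _) h) h′ m′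
  ... | inj₂ (here e)  = <-irrefl (sym (ℓ-injective h′ k< e)) h

  -- Consequently the letter `ℓ (suc k)` closing a block of level `k` occurs in it only at the end.
  Below-good : ∀ N k → k ≤ D → Below k (goodWord N k)
  Below-bad  : ∀ N k → k ≤ D → Below k (badWord N k)
  Below-good N zero    h j _ _ ()
  Below-good N (suc k) h = Below-rep (N k) (Below-block h (Below-bad N k (<⇒≤ h)))
  Below-bad N zero h j 0<j j≤ (here e) = <-irrefl (sym (ℓ-injective j≤ h e)) 0<j
  Below-bad N (suc k) h = Below-++ B (Below-++ (Below-block h (Below-good N k (<⇒≤ h))) B)
    where B = Below-rep (N k) (Below-block h (Below-bad N k (<⇒≤ h)))

  -- A closed prefix hides its own letters: each letter j < k in it is
  -- separated from the end of the prefix by a letter j + 1.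
  Closed : ℕ → Word (suc D) → Set
  Closed k w = ∀ j → j < k → ∀ p q → w ≡ p ++ ℓ j ∷ q → ℓ (suc j) ∈ q

  Closed-[] : ∀ k → Closed k []
  Closed-[] k j _ []      q ()
  Closed-[] k j _ (_ ∷ _) q ()

  Closed-≤ : ∀ {k k′ w} → k ≤ k′ → Closed k′ w → Closed k w
  Closed-≤ h f j j< = f j (<-≤-trans j< h)

  Closed-++ : ∀ {k u v} → Closed k u → Closed k v → Closed k (u ++ v)
  Closed-++ {u = u} {v} f g j h p q e with splitAt++ u v p (ℓ j) q e
  ... | inˡ r e′ refl = ∈-++⁺ˡ (f j h p r e′)
  ... | inʳ r e′ _    = g j h r q e′

  Closed-rep : ∀ {k w} N → Closed k w → Closed k (rep N w)
  Closed-rep zero    f = Closed-[] _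
  Closed-rep (suc N) f = Closed-++ f (Closed-rep N f)

  ℓ-suc-≢ : ∀ {j k} → j ≤ k → suc k ≤ D → ℓ j ≢ ℓ (suc k)
  ℓ-suc-≢ j≤k h e = <-irrefl (ℓ-injective (≤-trans j≤k (<⇒≤ h)) h e) (s≤s j≤k)

  -- The appended letter hides every `ℓ k`; lower letters are already hidden within `w`.
  Closed-block : ∀ {k w} → suc k ≤ D → Closed k w → Closed (suc k) (w ++ ℓ (suc k) ∷ [])
  Closed-block {k} {w} h f j (s≤s j≤k) p q e with splitLast w (ℓ (suc k)) p (ℓ j) q e
  ... | last _ e′ = ⊥-elim (ℓ-suc-≢ j≤k h (sym e′))
  ... | inside r e′ refl with m≤n⇒m<n∨m≡n j≤k
  ... | inj₁ j<k  = ∈-++⁺ˡ (f j j<k p r e′)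
  ... | inj₂ refl = ∈-++⁺ʳ r (here refl)

  Closed-good : ∀ N k → k ≤ D → Closed k (goodWord N k)
  Closed-bad  : ∀ N k → k ≤ D → Closed k (badWord N k)
  Closed-good N zero    h = Closed-[] 0
  Closed-good N (suc k) h = Closed-rep (N k) (Closed-block h (Closed-bad N k (<⇒≤ h)))
  Closed-bad N zero    h j ()
  Closed-bad N (suc k) h = Closed-++ B (Closed-++ (Closed-block h (Closed-good N k (<⇒≤ h))) B)
    where B = Closed-rep (N k) (Closed-block h (Closed-bad N k (<⇒≤ h)))

  -- Each claim follows from the other one level down. The prefix `p` is general so that the
  -- induction reaches words nested inside blocks; being closed, it offers no visible `ℓ k`.
  goodWord-good : ∀ N k → suc k ≤ D → ∀ {p} → Closed (suc k) p → Good (suc k) (p ++ goodWord N k)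
  badWord-bad   : ∀ N k → suc k ≤ D → ∀ {p} → Closed (suc k) p → Marked k (p ++ badWord N k)

  goodWord-good N zero h {p} c (p₀ , p₁ , e , nb , _) = nb (c 0 (s≤s z≤n) p₀ p₁ (trans (sym (++-identityʳ p)) e))
  goodWord-good N (suc k) h {p} c (p₀ , p₁ , e , nb , g)
    with splitAt++ p (goodWord N (suc k)) p₀ (ℓ (suc k)) p₁ e
  ... | inˡ r e′ refl = nb (∈-++⁺ˡ (c (suc k) ≤-refl p₀ r e′))
  ... | inʳ r e′ refl with splitRep (N k) (badBlock N k) r (ℓ (suc k)) p₁ e′
  ... | repSplit {i} {w₀ = w₀} {w₁} _ b refl _
    with splitLast (badWord N k) (ℓ (suc k)) w₀ (ℓ (suc k)) w₁ b
  ... | inside s b′ _ = Below-bad N k (<⇒≤ (<⇒≤ h)) (suc k) ≤-refl (<⇒≤ h)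
                          (subst (ℓ (suc k) ∈_) (sym b′) (∈-++⁺ʳ w₀ (here refl)))
  -- The candidate closes a block, so the prefix before it ends in `badWord N k` and is `Marked k`,
  -- contrary to `g`.
  ... | last refl _ =
    g (subst (Marked k) (++-assoc p _ _) (badWord-bad N k (<⇒≤ h) (Closed-++ (Closed-≤ (n≤1+n _) c)
        (Closed-rep i (Closed-block (<⇒≤ h) (Closed-bad N k (<⇒≤ (<⇒≤ h))))))))

  badWord-bad N zero h {p} c = p , [] , refl , (λ ()) , tt
  badWord-bad N (suc k) h {p} c =
    -- The witness is the letter closing the inserted `goodBlock N k`; the copies in `R` cannot hide
    -- it.
    (p ++ R) ++ goodWord N k , R , same ,
    Below-rep (N k) (Below-block (<⇒≤ h) (Below-bad N k (<⇒≤ (<⇒≤ h)))) (suc (suc k)) ≤-refl h ,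
    goodWord-good N k (<⇒≤ h) (Closed-++ (Closed-≤ (n≤1+n _) c)
      (Closed-rep (N k) (Closed-block (<⇒≤ h) (Closed-bad N k (<⇒≤ (<⇒≤ h))))))
    where
    R = rep (N k) (badBlock N k)
    open ≡-Reasoning
    same : p ++ (R ++ (goodBlock N k ++ R)) ≡ ((p ++ R) ++ goodWord N k) ++ ℓ (suc k) ∷ R
    same = begin
      p ++ (R ++ (goodBlock N k ++ R))              ≡⟨ ++-assoc p R _ ⟨
      (p ++ R) ++ (goodBlock N k ++ R)              ≡⟨ cong ((p ++ R) ++_) (++-assoc (goodWord N k) _ R) ⟩
      (p ++ R) ++ (goodWord N k ++ ℓ (suc k) ∷ R)   ≡⟨ ++-assoc (p ++ R) (goodWord N k) _ ⟨
      ((p ++ R) ++ goodWord N k) ++ ℓ (suc k) ∷ R   ∎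

  -- Separation by the sentences against similarity in the game.

  badWord⊨ : ∀ N k → suc k ≤ D → badWord N k ⊨2 badSentence k
  badWord⊨ N k h = let p , q , e , _ , g = badWord-bad N k h (Closed-[] _) in bad⇐ k (p , q , e , g)

  -- As `ℓ (suc k)` is absent from the word, any witness of the sentence is visible from its end and
  -- would make the whole word `Marked k`.
  goodWord⊭ : ∀ N k → suc k ≤ D → ¬ (goodWord N k ⊨2 badSentence k)
  goodWord⊭ N k h s = let p , q , e , g = bad⇒ k s in
    goodWord-good N k h (Closed-[] _) (p , q , e ,
      (λ m → Below-good N k (<⇒≤ h) (suc k) ≤-refl h
               (subst (ℓ (suc k) ∈_) (sym e) (∈-++⁺ʳ p (there m)))) , g)

  goodWord≼badWord : ∀ m k → Sim (rounds k m) (goodWord (exponent m) k) (badWord (exponent m) k)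
  goodWord≼badWord m zero    = tt
  -- The induction hypothesis compares the inserted good block with a bad one for `k` rounds;
  -- `exponent m k` is exactly the threshold of `k + 1` rounds.
  goodWord≼badWord m (suc k) = Sim-insert m (rounds k m)
    (Sim-++ (rounds k m) (goodWord≼badWord m k) (Sim-refl (rounds k m) _))
    _ _ _ ≤-refl ≤-refl ≤-refl

theorem3p1 : ∀ (d : ℕ) → 1 ≤ d →
    Σ ℕ (λ n → Σ (FO2Sentence n) (λ φ → AltDepthGreaterThan φ d))
-- Level `suc d` allows one round more than `d`, and its formulas and words use `ℓ 0` up to
-- `ℓ (suc (suc d))`. The sentence is fixed before `ψ`; only the exponents of the words depend on
-- `ψ`.
theorem3p1 d _ = suc (suc (suc d)) , badSentence (suc d) , λ k k≤d (ψ , same) →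
  let m = width ψ
      N = exponent m
      u = goodWord N (suc d)
      v = badWord N (suc d)
      u≼v = goodWord≼badWord m (suc d)
      -- Passing all picks of the first round leaves its swap, that is, the reverse game with `d`
      -- rounds.
      _ , v⇒u = Sim⇒⊨BC (suc d) d m ψ (m≤n⇒m≤1+n k≤d) k≤d ≤-refl u≼v (Sim-drop m _ u≼v)
  in goodWord⊭ N (suc d) ≤-refl
       (proj₂ (same u) (v⇒u (proj₁ (same v) (badWord⊨ N (suc d) ≤-refl))))
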